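{- For every sequent $\Gamma$: if $\Gamma$ is derivable in the calculus $\mathcal{C}_{\mathsf{IM}}$, then its formula interpretation $i(\Gamma)$ is a theorem of $\mathsf{IM}$, i.e. $\vdash_{\mathsf{IM}} i(\Gamma)$.
   Context: Language: $\mathcal{L}$ is generated by $\varphi ::= p \mid \bot \mid \varphi\wedge\varphi \mid \varphi\vee\varphi \mid \varphi\to\varphi \mid \Box\varphi \mid \Diamond\varphi$; $\neg\varphi := \varphi\to\bot$, $\top := \neg\bot$. Logic: $\mathsf{IM}$ is obtained by extending an axiomatisation of intuitionistic propositional logic over $\mathcal{L}$ with the rules "from $\varphi\to\psi$ infer $\Box\varphi\to\Box\psi$" and "from $\varphi\to\psi$ infer $\Diamond\varphi\to\Diamond\psi$" and the axioms $(\Box\varphi\wedge\Diamond\neg\varphi)\to\bot$ and $(\Box\top\to\Diamond\varphi)\to\Diamond\varphi$, closed under modus ponens and uniform substitution. Sequents: a marked formula is an input formula $\varphi^\bullet$ or an output formula $\varphi^\circ$ with $\varphi\in\mathcal{L}$. A block is $\{\Delta\}$ where $\Delta$ contains at most one marked formula; it is an input block if $\Delta=\varphi^\bullet$ or $\Delta$ is empty, and an output block if $\Delta=\varphi^\circ$. A sequent has the form $\Gamma=\Lambda,\Pi$ where $\Lambda$ is a finite multiset of input formulas and input blocks and $\Pi$ is empty, or one output formula $\varphi^\circ$, or one output block $\{\varphi^\circ\}$. Below $\Gamma$ ranges over sequents, $\Lambda$ over sequents with only input components, $|\Delta|$ is the number of formulas in $\Delta$, and all rule instances must consist of sequents. The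 output pruning $\Gamma^\downarrow$ is $\Gamma$ with its output formula (if any) removed; if the output formula is inside a block, the block is kept but emptied to $\{\ \}$. Formula interpretation: put $\iota(\varphi^\bullet)=\iota(\varphi^\circ)=\varphi$, $\iota(\{\ \})=\Box\top$, $\iota(\{\varphi^\bullet\})=\Box\varphi$, $\iota(\{\varphi^\circ\})=\Diamond\varphi$, $\iota(\emptyset)=\bot$, and $i(\Lambda,\Pi)=\big(\bigwedge_{x\in\Lambda}\iota(x)\big)\to\iota(\Pi)$, with empty conjunction $\top$. Rules of $\mathcal{C}_{\mathsf{IM}}$ (premisses / conclusion): $\bot^\bullet$: (no premiss) / $\Gamma,\bot^\bullet$. $\mathsf{id}$: (no premiss) / $\Lambda,p^\bullet,p^\circ$ ($p$ a proposition letter). $\wedge^\bullet$: $\Gamma,\varphi^\bullet,\psi^\bullet$ / $\Gamma,(\varphi\wedge\psi)^\bullet$. $\wedge^\circ$: $\Lambda,\varphi^\circ$ and $\Lambda,\psi^\circ$ / $\Lambda,(\varphi\wedge\psi)^\circ$. $\vee^\bullet$: $\Gamma,\varphi^\bullet$ and $\Gamma,\psi^\bullet$ / $\Gamma,(\varphi\vee\psi)^\bullet$. $\vee^\circ$: $\Lambda,\varphi^\circ$ / $\Lambda,(\varphi\vee\psi)^\circ$; and $\Lambda,\psi^\circ$ / $\Lambda,(\varphi\vee\psi)^\circ$. $\to^\bullet$: $\Gamma^\downarrow,(\varphi\to\psi)^\bullet,\varphi^\circ$ and $\Gamma,\psi^\bullet$ / $\Gamma,(\varphi\to\psi)^\bullet$.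 $\to^\circ$: $\Lambda,\varphi^\bullet,\psi^\circ$ / $\Lambda,(\varphi\to\psi)^\circ$. $\Box^\bullet$: $\Gamma,\{\varphi^\bullet\}$ / $\Gamma,(\Box\varphi)^\bullet$. $\Box^\circ$ ($|\Delta|\leq 1$): $\Delta,\varphi^\circ$ / $\Lambda,\{\Delta\},(\Box\varphi)^\circ$. $\Diamond^\bullet$ ($|\Delta|\leq 1$): $\varphi^\bullet,\Delta$ / $\Gamma,(\Diamond\varphi)^\bullet,\{\Delta\}$. $\Diamond^\circ$: $\Lambda,\{\varphi^\circ\}$ / $\Lambda,(\Diamond\varphi)^\circ$. -}

module Defs where

open import Data.List using (List; []; _∷_; map; foldr)
open import Data.List.Relation.Binary.Permutation.Propositional using (_↭_)
open import Data.Maybe using (Maybe; just; nothing)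
open import Data.Nat using (ℕ)

infix  20 □_ ◇_ ¬_
infixr 16 _∧_
infixr 15 _∨_
infixr 14 _⇒_
infix  8  _• _°
infix  4  _⨾_
infix  3  ⊢IM_ ⊢C_

-- Proposition letters are the natural numbers.
data Formula : Set where
  var         : ℕ → Formula
  ⊥           : Formula
  _∧_ _∨_ _⇒_ : Formula → Formula → Formula
  □_ ◇_       : Formula → Formula

¬_ : Formula → Formula
¬ φ = φ ⇒ ⊥

⊤ : Formula
⊤ = ¬ ⊥

substitute : (ℕ → Formula) → Formula → Formula
substitute σ (var p) = σ p
substitute σ ⊥       = ⊥
substitute σ (φ ∧ ψ) = substitute σ φ ∧ substitute σ ψ
substitute σ (φ ∨ ψ) = substitute σ φ ∨ substitute σ ψ
substitute σ (φ ⇒ ψ) = substitute σ φ ⇒ substitute σ ψ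
substitute σ (□ φ)   = □ substitute σ φ
substitute σ (◇ φ)   = ◇ substitute σ φ

data ⊢IM_ : Formula → Set where
  K     : ∀ {φ ψ}   → ⊢IM φ ⇒ ψ ⇒ φ
  S     : ∀ {φ ψ χ} → ⊢IM (φ ⇒ ψ ⇒ χ) ⇒ (φ ⇒ ψ) ⇒ φ ⇒ χ
  ∧-I   : ∀ {φ ψ}   → ⊢IM φ ⇒ ψ ⇒ φ ∧ ψ
  ∧-E₁  : ∀ {φ ψ}   → ⊢IM φ ∧ ψ ⇒ φ
  ∧-E₂  : ∀ {φ ψ}   → ⊢IM φ ∧ ψ ⇒ ψ
  ∨-I₁  : ∀ {φ ψ}   → ⊢IM φ ⇒ φ ∨ ψ
  ∨-I₂  : ∀ {φ ψ}   → ⊢IM ψ ⇒ φ ∨ ψ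
  ∨-E   : ∀ {φ ψ χ} → ⊢IM (φ ⇒ χ) ⇒ (ψ ⇒ χ) ⇒ φ ∨ ψ ⇒ χ
  ⊥-E   : ∀ {φ}     → ⊢IM ⊥ ⇒ φ
  □◇-⊥  : ∀ {φ}     → ⊢IM (□ φ ∧ ◇ ¬ φ) ⇒ ⊥
  □⊤-◇  : ∀ {φ}     → ⊢IM (□ ⊤ ⇒ ◇ φ) ⇒ ◇ φ
  mp    : ∀ {φ ψ}   → ⊢IM φ ⇒ ψ → ⊢IM φ → ⊢IM ψ
  usub  : ∀ {φ} (σ : ℕ → Formula) → ⊢IM φ → ⊢IM substitute σ φ
  □-mon : ∀ {φ ψ}   → ⊢IM φ ⇒ ψ → ⊢IM □ φ ⇒ □ ψ
  ◇-mon : ∀ {φ ψ}   → ⊢IM φ ⇒ ψ → ⊢IM ◇ φ ⇒ ◇ ψ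

data Polarity : Set where
  input output : Polarity

-- The content Δ of a block {Δ}: at most one marked formula.  An empty block
-- counts as an input block.
data Content : Polarity → Set where
  ∅  : Content input
  _• : Formula → Content input
  _° : Formula → Content output

data Component : Polarity → Set where
  _•  : Formula → Component input
  _°  : Formula → Component output
  ⟨_⟩ : ∀ {p} → Content p → Component p

-- Finite multisets are lists taken up to the permutation rule `exch` of the
-- calculus below.
Inputs : Set
Inputs = List (Component input)

Output : Set
Output = Maybe (Component output)

record Sequent : Set where
  constructor _⨾_
  field
    Λ : Inputs
    Π : Output

-- The output pruning Γ↓ has only input components.
_↓ : Sequent → Inputs
(Λ ⨾ nothing)        ↓ = Λ
(Λ ⨾ just (φ °))     ↓ = Λ
(Λ ⨾ just ⟨ φ ° ⟩)   ↓ = ⟨ ∅ ⟩ ∷ Λ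

ι : ∀ {p} → Component p → Formula
ι (φ •)     = φ
ι (φ °)     = φ
ι ⟨ ∅ ⟩     = □ ⊤
ι ⟨ φ • ⟩   = □ φ
ι ⟨ φ ° ⟩   = ◇ φ

ιΠ : Output → Formula
ιΠ nothing  = ⊥
ιΠ (just x) = ι x

⋀ : List Formula → Formula
⋀ = foldr _∧_ ⊤

i : Sequent → Formula
i (Λ ⨾ Π) = ⋀ (map ι Λ) ⇒ ιΠ Π

-- An input content viewed as a multiset outside its block.
unblock : Content input → Inputs
unblock ∅     = []
unblock (φ •) = φ • ∷ []

-- Λ ⨾ Π with arbitrary Π plays the role of Γ.  Since every rule instance must
-- consist of sequents, the block {Δ} in □° is an input block, whereas in ◇•
-- it is an input block (◇•-in) or the output block of the conclusion
-- (◇•-out), in which case the context is input-only.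
data ⊢C_ : Sequent → Set where
  exch   : ∀ {Λ Λ′ Π} → Λ ↭ Λ′ → ⊢C Λ ⨾ Π → ⊢C Λ′ ⨾ Π
  ⊥•     : ∀ {Λ Π} → ⊢C ⊥ • ∷ Λ ⨾ Π
  id     : ∀ {Λ} {p : ℕ} → ⊢C var p • ∷ Λ ⨾ just (var p °)
  ∧•     : ∀ {Λ Π φ ψ} → ⊢C φ • ∷ ψ • ∷ Λ ⨾ Π → ⊢C (φ ∧ ψ) • ∷ Λ ⨾ Π
  ∧°     : ∀ {Λ φ ψ} → ⊢C Λ ⨾ just (φ °) → ⊢C Λ ⨾ just (ψ °) →
           ⊢C Λ ⨾ just ((φ ∧ ψ) °)
  ∨•     : ∀ {Λ Π φ ψ} → ⊢C φ • ∷ Λ ⨾ Π → ⊢C ψ • ∷ Λ ⨾ Π →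
           ⊢C (φ ∨ ψ) • ∷ Λ ⨾ Π
  ∨°₁    : ∀ {Λ φ ψ} → ⊢C Λ ⨾ just (φ °) → ⊢C Λ ⨾ just ((φ ∨ ψ) °)
  ∨°₂    : ∀ {Λ φ ψ} → ⊢C Λ ⨾ just (ψ °) → ⊢C Λ ⨾ just ((φ ∨ ψ) °)
  ⇒•     : ∀ {Λ Π φ ψ} → ⊢C (φ ⇒ ψ) • ∷ (Λ ⨾ Π) ↓ ⨾ just (φ °) →
           ⊢C ψ • ∷ Λ ⨾ Π → ⊢C (φ ⇒ ψ) • ∷ Λ ⨾ Π
  ⇒°     : ∀ {Λ φ ψ} → ⊢C φ • ∷ Λ ⨾ just (ψ °) → ⊢C Λ ⨾ just ((φ ⇒ ψ) °)
  □•     : ∀ {Λ Π φ} → ⊢C ⟨ φ • ⟩ ∷ Λ ⨾ Π → ⊢C (□ φ) • ∷ Λ ⨾ Π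
  □°     : ∀ {Λ Δ φ} → ⊢C unblock Δ ⨾ just (φ °) →
           ⊢C ⟨ Δ ⟩ ∷ Λ ⨾ just ((□ φ) °)
  ◇•-in  : ∀ {Λ Π Δ φ} → ⊢C φ • ∷ unblock Δ ⨾ nothing →
           ⊢C (◇ φ) • ∷ ⟨ Δ ⟩ ∷ Λ ⨾ Π
  ◇•-out : ∀ {Λ φ ψ} → ⊢C φ • ∷ [] ⨾ just (ψ °) →
           ⊢C (◇ φ) • ∷ Λ ⨾ just ⟨ ψ ° ⟩
  ◇°     : ∀ {Λ φ} → ⊢C Λ ⨾ just ⟨ φ ° ⟩ → ⊢C Λ ⨾ just ((◇ φ) °)

{-# OPTIONS --safe #-}
module Submission where

open import Data.List using (map)
open import Data.List.Relation.Binary.Permutation.Propositional using (_↭_; refl; prep; swap; trans)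
open import Data.Maybe using (just; nothing)
open import Defs

-- Each rule is sound because ⇒ is a preorder with finite meets, joins and
-- exponentials on which □ and ◇ are monotone.  Only two rules need the modal
-- axioms.  In ◇• with an input block, φ entails ¬ δ, so □ δ ∧ ◇ φ yields
-- □ δ ∧ ◇ ¬ δ.  In ⇒• with an output block {χ°}, pruning leaves an extra
-- assumption □ ⊤, so one only obtains □ ⊤ ⇒ ◇ χ, which implies ◇ χ.

infixr 5 _⨟_

private
  variable
    α β γ δ φ ψ χ : Formula

⋀ι : Inputs → Formula
⋀ι Λ = ⋀ (map ι Λ)

const : ⊢IM φ → ⊢IM α ⇒ φ
const = mp K

apply : ⊢IM α ⇒ φ ⇒ ψ → ⊢IM α ⇒ φ → ⊢IM α ⇒ ψ
apply f x = mp (mp S f) x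

⇒-refl : ⊢IM φ ⇒ φ
⇒-refl {φ} = apply K (K {ψ = φ})

_⨟_ : ⊢IM φ ⇒ ψ → ⊢IM ψ ⇒ χ → ⊢IM φ ⇒ χ
f ⨟ g = apply (const g) f

pair : ⊢IM α ⇒ φ → ⊢IM α ⇒ ψ → ⊢IM α ⇒ φ ∧ ψ
pair f g = apply (f ⨟ ∧-I) g

curry : ⊢IM α ∧ φ ⇒ ψ → ⊢IM α ⇒ φ ⇒ ψ
curry f = ∧-I ⨟ mp S (const f)

⊤-intro : ⊢IM α ⇒ ⊤
⊤-intro = const ⇒-refl

∧-map : ⊢IM α ⇒ β → ⊢IM γ ⇒ δ → ⊢IM α ∧ γ ⇒ β ∧ δ
∧-map f g = pair (∧-E₁ ⨟ f) (∧-E₂ ⨟ g)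

∧-swap : ⊢IM α ∧ β ⇒ β ∧ α
∧-swap = pair ∧-E₂ ∧-E₁

⋀ι-↭ : ∀ {Λ Λ′} → Λ ↭ Λ′ → ⊢IM ⋀ι Λ′ ⇒ ⋀ι Λ
⋀ι-↭ refl         = ⇒-refl
⋀ι-↭ (prep _ π)   = ∧-map ⇒-refl (⋀ι-↭ π)
⋀ι-↭ (swap _ _ π) = pair (∧-E₂ ⨟ ∧-E₁) (∧-map ⇒-refl (∧-E₂ ⨟ ⋀ι-↭ π))
⋀ι-↭ (trans π ρ)  = ⋀ι-↭ ρ ⨟ ⋀ι-↭ π

↓-forget : ∀ Λ Π → ⊢IM ⋀ι ((Λ ⨾ Π) ↓) ⇒ ⋀ι Λ
↓-forget Λ nothing        = ⇒-refl
↓-forget Λ (just (χ °))   = ⇒-refl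
↓-forget Λ (just ⟨ χ ° ⟩) = ∧-E₂

↓-discharge : ∀ Λ Π → ⊢IM α ∧ ⋀ι ((Λ ⨾ Π) ↓) ⇒ ιΠ Π → ⊢IM α ∧ ⋀ι Λ ⇒ ιΠ Π
↓-discharge Λ nothing        f = f
↓-discharge Λ (just (χ °))   f = f
↓-discharge Λ (just ⟨ χ ° ⟩) f =
  -- The `□ ⊤` of the emptied block is regrouped as the last conjunct, so that `curry` turns it into
  -- the antecedent that `□⊤-◇` removes.
  curry (pair (∧-E₁ ⨟ ∧-E₁) (pair ∧-E₂ (∧-E₁ ⨟ ∧-E₂)) ⨟ f) ⨟ □⊤-◇

-- Chosen so that `ι ⟨ Δ ⟩` is `□` of it in both cases, which lets the modal rules treat empty and
-- filled blocks alike.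
contentFormula : Content input → Formula
contentFormula ∅     = ⊤
contentFormula (φ •) = φ

ι-block : ∀ Δ → ⊢IM ι ⟨ Δ ⟩ ⇒ □ contentFormula Δ
ι-block ∅     = ⇒-refl
ι-block (φ •) = ⇒-refl

⋀ι-unblock : ∀ Δ → ⊢IM contentFormula Δ ⇒ ⋀ι (unblock Δ)
⋀ι-unblock ∅     = ⇒-refl
⋀ι-unblock (φ •) = pair ⇒-refl ⊤-intro

-- `∨-E` carries no side context, so it is used with target `α ⇒ χ`.
∨-elim : ⊢IM φ ∧ α ⇒ χ → ⊢IM ψ ∧ α ⇒ χ → ⊢IM (φ ∨ ψ) ∧ α ⇒ χ
∨-elim f g = apply (∧-E₁ ⨟ mp (mp ∨-E (curry f)) (curry g)) ∧-E₂

theorem3p8 : (Γ : Sequent) → ⊢C Γ → ⊢IM i Γ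
theorem3p8 _ (exch π d)  = ⋀ι-↭ π ⨟ theorem3p8 _ d
theorem3p8 _ ⊥•          = ∧-E₁ ⨟ ⊥-E
theorem3p8 _ id          = ∧-E₁
theorem3p8 _ (∧• d)      = pair (∧-E₁ ⨟ ∧-E₁) (∧-map ∧-E₂ ⇒-refl) ⨟ theorem3p8 _ d
theorem3p8 _ (∧° d e)    = pair (theorem3p8 _ d) (theorem3p8 _ e)
theorem3p8 _ (∨• d e)    = ∨-elim (theorem3p8 _ d) (theorem3p8 _ e)
theorem3p8 _ (∨°₁ d)     = theorem3p8 _ d ⨟ ∨-I₁
theorem3p8 _ (∨°₂ d)     = theorem3p8 _ d ⨟ ∨-I₂
theorem3p8 _ (⇒• {Λ} {Π} d e) =
  -- The first premiss gives `φ` only under the pruned context, so both premisses are combined there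
  -- before the pruning is undone.
  ↓-discharge Λ Π
    (pair (apply ∧-E₁ (theorem3p8 _ d)) (∧-E₂ ⨟ ↓-forget Λ Π) ⨟ theorem3p8 _ e)
theorem3p8 _ (⇒° d)      = curry (∧-swap ⨟ theorem3p8 _ d)
-- Premiss and conclusion have the same interpretation, as also for `◇°`.
theorem3p8 _ (□• d)      = theorem3p8 _ d
theorem3p8 _ (□° {Δ = Δ} d) =
  ∧-E₁ ⨟ ι-block Δ ⨟ □-mon (⋀ι-unblock Δ ⨟ theorem3p8 _ d)
theorem3p8 _ (◇•-in {Δ = Δ} d) =
  pair (∧-E₂ ⨟ ∧-E₁ ⨟ ι-block Δ)
       -- The empty output of the premiss reads as `⊥`, so currying yields a negation.
       (∧-E₁ ⨟ ◇-mon (curry (∧-map ⇒-refl (⋀ι-unblock Δ) ⨟ theorem3p8 _ d)))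
  ⨟ □◇-⊥ ⨟ ⊥-E
theorem3p8 _ (◇•-out d)  = ∧-E₁ ⨟ ◇-mon (pair ⇒-refl ⊤-intro ⨟ theorem3p8 _ d)
theorem3p8 _ (◇° d)      = theorem3p8 _ d
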